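{- Let $D=(G,F)$ be a data flow framework over $\mathcal{T}$. Then for each $k\in V(G)$, $MOP(k)=H_D(k)$, i.e. the meet of all path congruences associated with paths from the entry point to $k$ equals the Herbrand Congruence at program point $k$ (the $k$-th component of the maximum fix-point of the composite transfer function $f_D$).
   Context: Terms. $C$ is a countable set of constants, $X$ a countable set of variables, and $\mathcal{T}$ is the set of formal expressions given by $t::=c\mid x\mid (t+t)$ with $c\in C$, $x\in X$. $t[x\leftarrow\alpha]$ denotes the term obtained from $t$ by replacing every occurrence of the variable $x$ by the term $\alpha$. $\mathcal{T}(y)$ is the set of terms in which $y$ appears, and $\overline{\mathcal{T}}(y)=\mathcal{T}\setminus\mathcal{T}(y)$. Congruences. For a partition $\mathcal{P}$ of $\mathcal{T}$ write $t\cong_{\mathcal{P}}t'$ if $t,t'$ lie in the same class. $\mathcal{P}$ is a congruence if: (1) distinct constants $c\neq c'$ satisfy $c\ncong_{\mathcal P} c'$; (2) for all $t,t',s,s'\in\mathcal{T}$, ($t'\cong_{\mathcal P} t$ and $s'\cong_{\mathcal P} s$) if and only if $t'+s'\cong_{\mathcal P} t+s$; (3) for $c\in C$, $t\in\mathcal{T}$, if $t\cong_{\mathcal P} c$ then $t=c$ or $t\in X$. $\mathcal{G}(\mathcal{T})$ is the set of all congruences, ordered by refinement: $\mathcal{P}\preceq\mathcal{P}'$ if each class of $\mathcal{P}$ is contained in a class of $\mathcal{P}'$. $\bot=\{\{t\}:t\in\mathcal{T}\}$. $\overline{\mathcal{G}(\mathcal{T})}=\mathcal{G}(\mathcal{T})\cup\{\top\}$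 where $\top$ is an added element with $\mathcal{P}\preceq\top$ for all $\mathcal{P}$; it is a complete lattice. $\wedge,\bigwedge$ denote greatest lower bounds in it; in particular $\bigwedge\emptyset=\top$. Transfer functions. For $y\in X$, $\beta\in\overline{\mathcal{T}}(y)$ and $\mathcal{P}\in\mathcal{G}(\mathcal{T})$, $f_{y=\beta}(\mathcal{P})$ is the congruence with $t\cong_{f_{y=\beta}(\mathcal{P})}t'$ iff $t[y\leftarrow\beta]\cong_{\mathcal{P}}t'[y\leftarrow\beta]$. The non-deterministic assignment $f_{y=*}(\mathcal{P})$ is the congruence with $t\cong_{f_{y=*}(\mathcal{P})}t'$ iff $t\cong_{\mathcal{P}}t'$ and $t[y\leftarrow\beta]\cong_{\mathcal{P}}t'[y\leftarrow\beta]$ for every $\beta\in\overline{\mathcal{T}}(y)$. Both kinds are called transfer functions, and are extended to $\overline{\mathcal{G}(\mathcal{T})}$ by $\top\mapsto\top$. Data flow frameworks. A control flow graph $G(V,E)$ is a directed graph on $V=\{1,\dots,n\}$, $n\ge1$, such that the entry point $1$ has no predecessors, and every vertex $i\neq1$ is reachable from $1$ and has one or two predecessors. Vertices with two predecessors are confluence points; vertices with exactly one predecessor are function points. $\mathrm{Pred}(k)$ is the set of predecessors of $k$. A data flow framework over $\mathcal{T}$ is $D=(G,F)$ with $G$ a control flow graph and $F=\{h_i: i \text{ a function point}\}$, where $h_i$ is a transfer function (used in its extended form $\overline{\mathcal{G}(\mathcal{T})}\to\overline{\mathcal{G}(\mathcal{T})}$) associated with the function point $i$. Composite transfer function and Herbrand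 congruence. On $\overline{\mathcal{G}(\mathcal{T})}^n$ use the componentwise order, with projections $\pi_i$. The composite transfer function $f_D:\overline{\mathcal{G}(\mathcal{T})}^n\to\overline{\mathcal{G}(\mathcal{T})}^n$ is the unique function whose components $\pi_k\circ f_D=f_k$ are: $f_1$ is constantly $\bot$; $f_k=h_k\circ\pi_j$ if $k$ is a function point with $\mathrm{Pred}(k)=\{j\}$; $f_k(\mathcal{P}_1,\dots,\mathcal{P}_n)=\mathcal{P}_i\wedge\mathcal{P}_j$ if $k$ is a confluence point with $\mathrm{Pred}(k)=\{i,j\}$. $f_D$ has a maximum fix-point (a fix-point that is $\succeq$ every fix-point); the Herbrand Congruence function $H_D:V(G)\to\overline{\mathcal{G}(\mathcal{T})}$ is this maximum fix-point, $H_D(k)$ being its $k$-th component. Paths. A path of length $l\ge0$ to $k\in V(G)$ is a sequence $\alpha=(v_0,v_1,\dots,v_l)$ with $v_0=1$, $v_l=k$ and $(v_{i-1},v_i)\in E(G)$ for $1\le i\le l$ (vertices may repeat); $\alpha_i=(v_0,\dots,v_i)$. The path congruence $m_\alpha$ is defined by $m_{\alpha_0}=\bot$; for $i>0$, $m_{\alpha_i}=h_j(m_{\alpha_{i-1}})$ if $v_i=j$ is a function point, and $m_{\alpha_i}=m_{\alpha_{i-1}}$ if $v_i$ is a confluence point; $m_\alpha=m_{\alpha_l}$. $MOP(k)=\bigwedge\{m_\alpha:\alpha \text{ a path (of any length) from } 1 \text{ to } k\}$. -}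

module Defs where

open import Data.Fin using (Fin; zero; _≟_)
open import Data.Fin.Subset using (Subset; _∈_; ⁅_⁆; _∪_; ⊥)
open import Data.Maybe using (map)
open import Data.Nat using (ℕ; suc)
open import Data.Product using (_×_; _,_; proj₁; proj₂; ∃; ∃-syntax)
open import Data.Sum using (_⊎_; inj₁; inj₂)
open import Function.Base using (id)
open import Function.Bundles using (_↣_; _⇔_; mk⇔; Equivalence)
open import Level using (0ℓ; _⊔_)
open import Relation.Binary.Core using (Rel; _⇒_)
open import Relation.Binary.Definitions using (DecidableEquality)
open import Relation.Binary.Lattice.Definitions using (Infimum)
open import Relation.Binary.PropositionalEquality
  using (_≡_; _≢_; refl; cong₂) renaming (isEquivalence to ≡-isEquivalence)
import Relation.Binary.Construct.Add.Supremum.Equality as AddTopEquality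
import Relation.Binary.Construct.Add.Supremum.NonStrict as AddTopOrder
open import Relation.Binary.Structures using (IsEquivalence)
open import Relation.Nullary using (¬_; yes; no)
open import Relation.Nullary.Construct.Add.Supremum using (_⁺; ⊤⁺; [_])
open import Relation.Nullary.Decidable using (via-injection)
import Data.Nat.Properties as ℕ

-- Countable means at most countable: finite (even empty) sets are allowed.
Countable : Set → Set
Countable A = A ↣ ℕ

IsGreatestLowerBound : ∀ {a ℓ i} {A : Set a} (_≤_ : Rel A ℓ) {I : Set i} →
                       (I → A) → A → Set (a ⊔ ℓ ⊔ i)
IsGreatestLowerBound _≤_ f m =
  (∀ i → m ≤ f i) × (∀ b → (∀ i → b ≤ f i) → b ≤ m)

-- A directed graph on Fin n is given by its predecessor sets: there is an
-- edge from i to j iff i ∈ Pred j.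

module _ {m : ℕ} (Pred : Fin (suc m) → Subset (suc m)) where

  data Path : Fin (suc m) → Set where
    start : Path zero
    _▷_   : ∀ {i j} → Path i → i ∈ Pred j → Path j

  FunctionPoint : Fin (suc m) → Set
  FunctionPoint k = ∃[ j ] Pred k ≡ ⁅ j ⁆

  ConfluencePoint : Fin (suc m) → Set
  ConfluencePoint k = ∃[ i ] ∃[ j ] i ≢ j × Pred k ≡ ⁅ i ⁆ ∪ ⁅ j ⁆

-- The n ≥ 1 vertices 1, …, n are the elements of Fin (suc m); the entry
-- point is zero.

record ControlFlowGraph : Set where
  field
    {m} : ℕ

  Vertex : Set
  Vertex = Fin (suc m)

  entry : Vertex
  entry = zero

  field
    Pred       : Vertex → Subset (suc m)
    entry-pred : Pred entry ≡ ⊥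
    reachable  : ∀ k → k ≢ entry → Path Pred k
    point      : ∀ k → k ≢ entry → FunctionPoint Pred k ⊎ ConfluencePoint Pred k

  data PointKind (k : Vertex) : Set where
    entryPoint      : k ≡ entry → PointKind k
    functionPoint   : FunctionPoint Pred k → PointKind k
    confluencePoint : ConfluencePoint Pred k → PointKind k

  kind : ∀ k → PointKind k
  kind k with k ≟ entry
  ... | yes k≡1 = entryPoint k≡1
  ... | no  k≢1 with point k k≢1
  ...   | inj₁ fp = functionPoint fp
  ...   | inj₂ cp = confluencePoint cp

module Herbrand {C X : Set} (C-countable : Countable C) (X-countable : Countable X) where

  _≟ˣ_ : DecidableEquality X
  _≟ˣ_ = via-injection X-countable ℕ._≟_

  infixl 6 _⊕_

  data Term : Set where
    con : C → Term
    var : X → Term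
    _⊕_ : Term → Term → Term

  data _AppearsIn_ (y : X) : Term → Set where
    here  : y AppearsIn var y
    left  : ∀ {t s} → y AppearsIn t → y AppearsIn (t ⊕ s)
    right : ∀ {t s} → y AppearsIn s → y AppearsIn (t ⊕ s)

  infix 8 _[_←_]

  _[_←_] : Term → X → Term → Term
  con c   [ y ← β ] = con c
  var x   [ y ← β ] with x ≟ˣ y
  ... | yes _ = β
  ... | no  _ = var x
  (t ⊕ s) [ y ← β ] = t [ y ← β ] ⊕ s [ y ← β ]

  -- A partition of Term is represented by its equivalence relation, "lies in
  -- the same class as"; equality of partitions is _≈_ below.

  record IsCongruence (_≅_ : Rel Term 0ℓ) : Set where
    field
      isEquivalence  : IsEquivalence _≅_
      con-distinct   : ∀ {c c′} → c ≢ c′ → ¬ (con c ≅ con c′)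
      ⊕-congruence   : ∀ {t t′ s s′} → (t′ ≅ t × s′ ≅ s) ⇔ ((t′ ⊕ s′) ≅ (t ⊕ s))
      con-class      : ∀ {c t} → t ≅ con c → t ≡ con c ⊎ ∃[ x ] t ≡ var x

  record Congruence : Set₁ where
    infix 4 _≅_
    field
      _≅_          : Rel Term 0ℓ
      isCongruence : IsCongruence _≅_
    open IsCongruence isCongruence public
    open IsEquivalence isEquivalence public
      using () renaming (refl to ≅-refl; sym to ≅-sym; trans to ≅-trans)

  infix 4 _≈_ _⪯_

  _≈_ : Rel Congruence 0ℓ
  P ≈ Q = ∀ t t′ → t P.≅ t′ ⇔ t Q.≅ t′
    where module P = Congruence P
          module Q = Congruence Q

  _⪯_ : Rel Congruence 0ℓ
  P ⪯ Q = Congruence._≅_ P ⇒ Congruence._≅_ Q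

  ⊥ᶜ : Congruence
  ⊥ᶜ = record
    { _≅_          = _≡_
    ; isCongruence = record
      { isEquivalence = ≡-isEquivalence
      ; con-distinct  = λ { c≢c′ refl → c≢c′ refl }
      ; ⊕-congruence  = mk⇔ (λ (p , q) → cong₂ _⊕_ p q) λ { refl → refl , refl }
      ; con-class     = inj₁
      }
    }

  Congruence⁺ : Set₁
  Congruence⁺ = Congruence ⁺

  open AddTopOrder _⪯_ public using ([_]; _≤⊤⁺) renaming (_≤⁺_ to _⪯⁺_)
  open AddTopEquality _≈_ public using (_≈⁺_)

  _∩_ : Congruence → Congruence → Congruence
  P ∩ Q = record
    { _≅_          = λ t t′ → t P.≅ t′ × t Q.≅ t′
    ; isCongruence = record
      { isEquivalence = record
        { refl  = P.≅-refl , Q.≅-refl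
        ; sym   = λ (p , q) → P.≅-sym p , Q.≅-sym q
        ; trans = λ (p , q) (p′ , q′) → P.≅-trans p p′ , Q.≅-trans q q′
        }
      ; con-distinct = λ c≢c′ (p , _) → P.con-distinct c≢c′ p
      ; ⊕-congruence = mk⇔
          (λ ((p , q) , (p′ , q′)) →
            Equivalence.to P.⊕-congruence (p , p′) , Equivalence.to Q.⊕-congruence (q , q′))
          (λ (p , q) →
            let (p₁ , p₂) = Equivalence.from P.⊕-congruence p
                (q₁ , q₂) = Equivalence.from Q.⊕-congruence q
            in (p₁ , q₁) , (p₂ , q₂))
      ; con-class    = λ (p , _) → P.con-class p
      }
    }
    where module P = Congruence P
          module Q = Congruence Q

  _∧_ : Congruence⁺ → Congruence⁺ → Congruence⁺
  ⊤⁺    ∧ Q     = Q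
  [ P ] ∧ ⊤⁺    = [ P ]
  [ P ] ∧ [ Q ] = [ P ∩ Q ]

  ⪯⁺-refl : ∀ P → P ⪯⁺ P
  ⪯⁺-refl [ P ] = [ id ]
  ⪯⁺-refl ⊤⁺    = ⊤⁺ ≤⊤⁺

  ∧-infimum : Infimum _⪯⁺_ _∧_
  ∧-infimum ⊤⁺    Q     = (Q ≤⊤⁺) , ⪯⁺-refl Q , λ _ _ R⪯Q → R⪯Q
  ∧-infimum [ P ] ⊤⁺    = ⪯⁺-refl [ P ] , ([ P ] ≤⊤⁺) , λ _ R⪯P _ → R⪯P
  ∧-infimum [ P ] [ Q ] = [ (λ (p , _) → p) ] , [ (λ (_ , q) → q) ] ,
                          λ { _ [ R⪯P ] [ R⪯Q ] → [ (λ r → R⪯P r , R⪯Q r) ] }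

  data TransferFunction : Set where
    assign       : (y : X) (β : Term) → ¬ (y AppearsIn β) → TransferFunction
    assignNondet : (y : X) → TransferFunction

  subst-con-class : ∀ (P : Congruence) y β {c} t → Congruence._≅_ P (t [ y ← β ]) (con c) →
                    t ≡ con c ⊎ ∃[ x ] t ≡ var x
  subst-con-class P y β (con c) p with Congruence.con-class P p
  ... | inj₁ eq = inj₁ eq
  subst-con-class P y β (var x) p = inj₂ (x , refl)
  subst-con-class P y β (t ⊕ s) p with Congruence.con-class P p
  ... | inj₁ ()
  ... | inj₂ (_ , ())

  -- The side condition that y does not appear in β is carried by assign.
  f[_≔_] : X → Term → Congruence → Congruence
  f[ y ≔ β ] P = record
    { _≅_          = λ t t′ → t [ y ← β ] P.≅ t′ [ y ← β ]
    ; isCongruence = record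
      { isEquivalence = record { refl = P.≅-refl ; sym = P.≅-sym ; trans = P.≅-trans }
      ; con-distinct  = P.con-distinct
      ; ⊕-congruence  = P.⊕-congruence
      ; con-class     = λ {_} {t} → subst-con-class P y β t
      }
    }
    where module P = Congruence P

  f[_≔*] : X → Congruence → Congruence
  f[ y ≔*] P = record
    { _≅_          = λ t t′ → t P.≅ t′ ×
                       (∀ β → ¬ (y AppearsIn β) → t [ y ← β ] P.≅ t′ [ y ← β ])
    ; isCongruence = record
      { isEquivalence = record
        { refl  = P.≅-refl , λ _ _ → P.≅-refl
        ; sym   = λ (p , q) → P.≅-sym p , λ β y∉β → P.≅-sym (q β y∉β)
        ; trans = λ (p , q) (p′ , q′) →
                    P.≅-trans p p′ , λ β y∉β → P.≅-trans (q β y∉β) (q′ β y∉β)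
        }
      ; con-distinct = λ c≢c′ (p , _) → P.con-distinct c≢c′ p
      ; ⊕-congruence = mk⇔
          (λ ((p , q) , (p′ , q′)) →
            Equivalence.to P.⊕-congruence (p , p′) ,
            λ β y∉β → Equivalence.to P.⊕-congruence (q β y∉β , q′ β y∉β))
          (λ (p , q) →
            let (p₁ , p₂) = Equivalence.from P.⊕-congruence p
                q₁₂ = λ β y∉β → Equivalence.from P.⊕-congruence (q β y∉β)
            in (p₁ , λ β y∉β → proj₁ (q₁₂ β y∉β)) ,
               (p₂ , λ β y∉β → proj₂ (q₁₂ β y∉β)))
      ; con-class    = λ (p , _) → P.con-class p
      }
    }
    where module P = Congruence P

  ⟦_⟧ : TransferFunction → Congruence → Congruence
  ⟦ assign y β _   ⟧ = f[ y ≔ β ]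
  ⟦ assignNondet y ⟧ = f[ y ≔*]

  -- map sends ⊤⁺ to ⊤⁺.
  ⟦_⟧⁺ : TransferFunction → Congruence⁺ → Congruence⁺
  ⟦ h ⟧⁺ = map ⟦ h ⟧

  record DataFlowFramework : Set where
    field
      G : ControlFlowGraph
    open ControlFlowGraph G public
    field
      -- The irrelevant argument makes h k depend on the vertex k only.
      h : ∀ k → .(FunctionPoint Pred k) → TransferFunction

    composite : (Vertex → Congruence⁺) → (Vertex → Congruence⁺)
    composite P k with kind k
    ... | entryPoint _                  = [ ⊥ᶜ ]
    ... | functionPoint fp@(j , _)      = ⟦ h k fp ⟧⁺ (P j)
    ... | confluencePoint (i , j , _)   = P i ∧ P j

    IsFixPoint : (Vertex → Congruence⁺) → Set₁
    IsFixPoint P = ∀ k → composite P k ≈⁺ P k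

    IsHerbrandCongruence : (Vertex → Congruence⁺) → Set₁
    IsHerbrandCongruence H =
      IsFixPoint H × (∀ P → IsFixPoint P → ∀ k → P k ⪯⁺ H k)

    pathCongruence : ∀ {k} → Path Pred k → Congruence⁺
    pathCongruence start = [ ⊥ᶜ ]
    pathCongruence (_▷_ {j = k} α _) with kind k
    ... | entryPoint _      = pathCongruence α  -- impossible: the entry has no predecessors
    ... | functionPoint fp  = ⟦ h k fp ⟧⁺ (pathCongruence α)
    ... | confluencePoint _ = pathCongruence α

    IsMOP : (Vertex → Congruence⁺) → Set₁
    IsMOP M = ∀ k → IsGreatestLowerBound _⪯⁺_ (pathCongruence {k}) (M k)

{-# OPTIONS --safe #-}

-- Every path congruence is a genuine congruence (never ⊤), and every vertex is
-- reached by some path, so MOP(k) is the intersection of a nonempty family of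
-- congruences. Transfer functions commute with such intersections; splitting
-- the paths to k by their last edge therefore makes MOP a fix-point of the
-- composite transfer function. Conversely, by induction along a path, every
-- fix-point lies below each path congruence and hence below MOP.

module Submission where

open import Defs
open import Data.Fin using (zero; suc; _≟_)
open import Data.Fin.Subset using (_∈_; ⁅_⁆; _∪_)
open import Data.Fin.Subset.Properties
  using (∉⊥; x∈⁅x⁆; x∈⁅y⁆⇒x≡y; x∈p∪q⁻; x∈p∪q⁺)
open import Data.Product using (_×_; _,_; proj₁; proj₂; ∃)
open import Data.Sum using (_⊎_; inj₁; inj₂)
import Data.Sum as Sum
open import Function.Base using (case_of_)
open import Function.Bundles using (_⇔_; mk⇔; Equivalence)
open import Function.Construct.Symmetry using (⇔-sym)
open import Level using (0ℓ)
open import Relation.Binary.Core using (Rel)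
open import Relation.Binary.Definitions using (Transitive; Antisymmetric)
open import Relation.Binary.PropositionalEquality using (_≡_; refl; sym; cong; subst)
import Relation.Binary.Construct.Add.Supremum.Equality as AddTopEquality
import Relation.Binary.Construct.Add.Supremum.NonStrict as AddTopOrder
open import Relation.Nullary using (¬_; yes; no; contradiction)
open import Relation.Nullary.Construct.Add.Supremum using (⊤⁺; [_])

module _ {C X : Set} (C-countable : Countable C) (X-countable : Countable X) where

  open Herbrand C-countable X-countable
  open Congruence using (_≅_)
  open AddTopEquality _≈_ using () renaming ([_] to ≈[_]; ≈⁺-sym to lift-sym)
  private module Order = AddTopOrder _⪯_

  ⪯⁺-trans : Transitive _⪯⁺_
  ⪯⁺-trans = Order.≤⁺-trans λ P⪯Q Q⪯R p → Q⪯R (P⪯Q p)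

  ⪯⁺-antisym : Antisymmetric _≈⁺_ _⪯⁺_
  ⪯⁺-antisym = Order.≤⁺-antisym λ P⪯Q Q⪯P _ _ → mk⇔ P⪯Q Q⪯P

  ⪯⁺-reflexive : ∀ {P Q} → P ≈⁺ Q → P ⪯⁺ Q
  ⪯⁺-reflexive = Order.≤⁺-reflexive λ P≈Q {t} {t′} → Equivalence.to (P≈Q t t′)

  ≈⁺-sym : ∀ {P Q} → P ≈⁺ Q → Q ≈⁺ P
  ≈⁺-sym = lift-sym λ P≈Q t t′ → ⇔-sym (P≈Q t t′)

  ⟦⟧-mono : ∀ h {P Q} → P ⪯ Q → ⟦ h ⟧ P ⪯ ⟦ h ⟧ Q
  ⟦⟧-mono (assign _ _ _)   P⪯Q p       = P⪯Q p
  ⟦⟧-mono (assignNondet _) P⪯Q (p , q) = P⪯Q p , λ β y∉β → P⪯Q (q β y∉β)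

  ⟦⟧⁺-mono : ∀ h {P Q} → P ⪯⁺ Q → ⟦ h ⟧⁺ P ⪯⁺ ⟦ h ⟧⁺ Q
  ⟦⟧⁺-mono h {P} {Q} [ P⪯Q ] = [ ⟦⟧-mono h P⪯Q ]
  ⟦⟧⁺-mono h (P ≤⊤⁺)         = ⟦ h ⟧⁺ P ≤⊤⁺

  -- The element of I excludes the empty meet, which is ⊤⁺.
  ⋂ : {I : Set} → I → (I → Congruence) → Congruence
  ⋂ i₀ P = record
    { _≅_          = λ t t′ → ∀ i → _≅_ (P i) t t′
    ; isCongruence = record
      { isEquivalence = record
        { refl  = λ i → Congruence.≅-refl (P i)
        ; sym   = λ p i → Congruence.≅-sym (P i) (p i)
        ; trans = λ p q i → Congruence.≅-trans (P i) (p i) (q i)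
        }
      ; con-distinct = λ c≢c′ p → Congruence.con-distinct (P i₀) c≢c′ (p i₀)
      ; ⊕-congruence = mk⇔
          (λ (p , q) i → Equivalence.to (Congruence.⊕-congruence (P i)) (p i , q i))
          (λ p → let pq = λ i → Equivalence.from (Congruence.⊕-congruence (P i)) (p i)
                 in (λ i → proj₁ (pq i)) , λ i → proj₂ (pq i))
      ; con-class    = λ p → Congruence.con-class (P i₀) (p i₀)
      }
    }

  ⋂-greatest : {I : Set} (i₀ : I) (P : I → Congruence) →
               IsGreatestLowerBound _⪯⁺_ (λ i → [ P i ]) [ ⋂ i₀ P ]
  ⋂-greatest i₀ P = (λ i → [ (λ p → p i) ]) , greatest
    where
    greatest : ∀ Q → (∀ i → Q ⪯⁺ [ P i ]) → Q ⪯⁺ [ ⋂ i₀ P ]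
    -- `⊤⁺` is a lower bound of the empty family only, and `i₀` is a member of this one.
    greatest ⊤⁺    Q⪯P with () ← Q⪯P i₀
    greatest [ Q ] Q⪯P = [ (λ q i → Order.[≤]-injective (Q⪯P i) q) ]

  -- Each transfer function relates terms by a conjunction of conditions on the argument congruence,
  -- so only universal quantifiers have to be interchanged. For `assign` both sides unfold to the
  -- same relation.
  ⟦⟧-⋂ : ∀ h {I : Set} (i₀ : I) P → ⟦ h ⟧ (⋂ i₀ P) ≈ ⋂ i₀ (λ i → ⟦ h ⟧ (P i))
  ⟦⟧-⋂ (assign _ _ _)   i₀ P t t′ = mk⇔ (λ p → p) (λ p → p)
  ⟦⟧-⋂ (assignNondet _) i₀ P t t′ = mk⇔
    (λ (p , q) i → p i , λ β y∉β → q β y∉β i)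
    (λ p → (λ i → proj₁ (p i)) , λ β y∉β i → proj₂ (p i) β y∉β)

  module _ (D : DataFlowFramework) where

    open DataFlowFramework D

    no-edge-to-entry : ∀ {i k} → k ≡ entry → ¬ (i ∈ Pred k)
    no-edge-to-entry refl e = ∉⊥ (subst (_ ∈_) entry-pred e)

    ∈-function-pred : ∀ {i k} j → Pred k ≡ ⁅ j ⁆ → i ∈ Pred k → i ≡ j
    ∈-function-pred j Pred≡ e = x∈⁅y⁆⇒x≡y j (subst (_ ∈_) Pred≡ e)

    function-pred-∈ : ∀ {k} j → Pred k ≡ ⁅ j ⁆ → j ∈ Pred k
    function-pred-∈ j Pred≡ = subst (j ∈_) (sym Pred≡) (x∈⁅x⁆ j)

    ∈-confluence-pred : ∀ {i k} j j′ → Pred k ≡ ⁅ j ⁆ ∪ ⁅ j′ ⁆ → i ∈ Pred k → i ≡ j ⊎ i ≡ j′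
    ∈-confluence-pred j j′ Pred≡ e =
      Sum.map (x∈⁅y⁆⇒x≡y j) (x∈⁅y⁆⇒x≡y j′) (x∈p∪q⁻ _ _ (subst (_ ∈_) Pred≡ e))

    confluence-pred-∈ : ∀ {i k} j j′ → Pred k ≡ ⁅ j ⁆ ∪ ⁅ j′ ⁆ → i ≡ j ⊎ i ≡ j′ → i ∈ Pred k
    confluence-pred-∈ j j′ Pred≡ i≡ = subst (_ ∈_) (sym Pred≡)
      (x∈p∪q⁺ (Sum.map (λ { refl → x∈⁅x⁆ _ }) (λ { refl → x∈⁅x⁆ _ }) i≡))

    -- Supplies the index that makes the intersection over paths nonempty; reachability covers every
    -- vertex but the entry, which has the path of length 0.
    path : ∀ k → Path Pred k
    path k with k ≟ entry
    ... | yes refl = start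
    ... | no  k≢1  = reachable k k≢1

    -- The point kind is an argument, rather than computed by a `with` inside, so that a later case
    -- split on `kind` reduces it.
    step : ∀ {k} → PointKind k → Congruence → Congruence
    step     (entryPoint _)      P = P
    step {k} (functionPoint fp)  P = ⟦ h k fp ⟧ P
    step     (confluencePoint _) P = P

    pathCongruence₀ : ∀ {k} → Path Pred k → Congruence
    pathCongruence₀ start              = ⊥ᶜ
    pathCongruence₀ (_▷_ {j = k} α _) = step (kind k) (pathCongruence₀ α)

    pathCongruence-proper : ∀ {k} (α : Path Pred k) → pathCongruence α ≡ [ pathCongruence₀ α ]
    pathCongruence-proper start = refl
    pathCongruence-proper (_▷_ {j = k} α _) with kind k
    ... | entryPoint _      = pathCongruence-proper α
    ... | functionPoint fp  = cong ⟦ h k fp ⟧⁺ (pathCongruence-proper α)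
    ... | confluencePoint _ = pathCongruence-proper α

    mop₀ : Vertex → Congruence
    mop₀ k = ⋂ (path k) pathCongruence₀

    mop : Vertex → Congruence⁺
    mop k = [ mop₀ k ]

    mop-isMOP : IsMOP mop
    mop-isMOP k with lower , greatest ← ⋂-greatest (path k) pathCongruence₀ =
      (λ α → subst (mop k ⪯⁺_) (sym (pathCongruence-proper α)) (lower α)) ,
      λ Q Q⪯ → greatest Q λ α → subst (Q ⪯⁺_) (pathCongruence-proper α) (Q⪯ α)

    AlongLastEdge : ∀ {k} → PointKind k → Rel Term 0ℓ
    AlongLastEdge {k} κ t t′ =
      ∀ i → i ∈ Pred k → (α : Path Pred i) → _≅_ (step κ (pathCongruence₀ α)) t t′

    -- A path to `suc k` cannot be `start`, so it is a path to a predecessor followed by one edge.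
    mop-lastEdge : ∀ k t t′ → AlongLastEdge (kind (suc k)) t t′ ⇔ _≅_ (mop₀ (suc k)) t t′
    mop-lastEdge k t t′ = mk⇔ (λ { p (α ▷ e) → p _ e α }) (λ p _ e α → p (α ▷ e))

    mop-isFixPoint : IsFixPoint mop
    mop-isFixPoint zero = ≈[ (λ t t′ → mk⇔
      -- No edge enters the entry, so `start` is its only path.
      (λ { t≡t′ start → t≡t′ ; _ (_ ▷ e) → contradiction e (no-edge-to-entry refl) })
      (λ p → p start)) ]
    -- Abstracting `mop-lastEdge` along with the kind lets each case evaluate `step` in its type.
    mop-isFixPoint (suc k) with kind (suc k) | mop-lastEdge k
    ... | functionPoint fp@(j , Pred≡) | lastEdge = ≈[ (λ t t′ →
      let h-⋂ = ⟦⟧-⋂ (h (suc k) fp) (path j) pathCongruence₀ t t′ in mk⇔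
        (λ p → Equivalence.to (lastEdge t t′) λ _ e α →
          case ∈-function-pred j Pred≡ e of λ { refl → Equivalence.to h-⋂ p α })
        (λ p → Equivalence.from h-⋂
          (Equivalence.from (lastEdge t t′) p j (function-pred-∈ j Pred≡)))) ]
    -- Here `step` is the identity, and the last edge splits the paths into those through `i` and
    -- those through `j`.
    ... | confluencePoint (i , j , _ , Pred≡) | lastEdge = ≈[ (λ t t′ → mk⇔
        (λ (p , q) → Equivalence.to (lastEdge t t′) λ _ e α →
          case ∈-confluence-pred i j Pred≡ e of λ { (inj₁ refl) → p α ; (inj₂ refl) → q α })
        (λ p → let p′ = Equivalence.from (lastEdge t t′) p in
          p′ i (confluence-pred-∈ i j Pred≡ (inj₁ refl)) ,
          p′ j (confluence-pred-∈ i j Pred≡ (inj₂ refl)))) ]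

    -- The fix-point equation unfolds `P k` at each edge. Monotonicity carries the bound through a
    -- transfer function; at a confluence point the meet lies below the branch the path came from.
    fixPoint-below-path : ∀ P → IsFixPoint P → ∀ {k} (α : Path Pred k) → P k ⪯⁺ pathCongruence α
    fixPoint-below-path P fix start = ⪯⁺-reflexive (≈⁺-sym (fix entry))
    fixPoint-below-path P fix (_▷_ {i} {k} α e)
      with kind k | fix k | fixPoint-below-path P fix α
    ... | entryPoint k≡1 | _ | _ = contradiction e (no-edge-to-entry k≡1)
    ... | functionPoint fp@(j , Pred≡) | hPj≈ | Pi⪯ with refl ← ∈-function-pred j Pred≡ e =
      ⪯⁺-trans (⪯⁺-reflexive (≈⁺-sym hPj≈)) (⟦⟧⁺-mono (h k fp) Pi⪯)
    ... | confluencePoint (j , j′ , _ , Pred≡) | ∧≈ | Pi⪯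
        with lower₁ , lower₂ , _ ← ∧-infimum (P j) (P j′) =
      ⪯⁺-trans (⪯⁺-reflexive (≈⁺-sym ∧≈)) (case ∈-confluence-pred j j′ Pred≡ e of λ
        { (inj₁ refl) → ⪯⁺-trans lower₁ Pi⪯ ; (inj₂ refl) → ⪯⁺-trans lower₂ Pi⪯ })

    fixPoint-below-MOP : ∀ {M P} → IsMOP M → IsFixPoint P → ∀ k → P k ⪯⁺ M k
    fixPoint-below-MOP M-MOP fix k = proj₂ (M-MOP k) _ (fixPoint-below-path _ fix)

    mop-isHerbrandCongruence : IsHerbrandCongruence mop
    mop-isHerbrandCongruence =
      mop-isFixPoint , λ P fix → fixPoint-below-MOP mop-isMOP fix

theorem10p7 : {C X : Set} (C-countable : Countable C) (X-countable : Countable X) →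
    let open Herbrand C-countable X-countable in
    (D : DataFlowFramework) →
    let open DataFlowFramework D in
    ∃ IsMOP × ∃ IsHerbrandCongruence ×
    (∀ MOP H → IsMOP MOP → IsHerbrandCongruence H → ∀ k → MOP k ≈⁺ H k)
theorem10p7 C-countable X-countable D =
  (M , M-isMOP) , (M , M-isHerbrandCongruence) ,
  -- An arbitrary `MOP` is not yet known to be a fix-point, so it is compared with `H` through `M`,
  -- which is one.
  λ MOP H MOP-isMOP (H-fix , H-max) k → ⪯⁺-antisym _ _
    (⪯⁺-trans _ _
      (proj₂ (M-isMOP k) _ (proj₁ (MOP-isMOP k)))
      (H-max _ (proj₁ M-isHerbrandCongruence) k))
    (fixPoint-below-MOP _ _ D MOP-isMOP H-fix k)
  where
  M = mop C-countable X-countable D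
  M-isMOP = mop-isMOP C-countable X-countable D
  M-isHerbrandCongruence = mop-isHerbrandCongruence C-countable X-countable D
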